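{- Let $S$ be a set of symbols with $|S| = 6$. In the nonrepetitive game over $S$, Ann has a strategy to build an arbitrarily long sequence with no repetitions of size greater than $1$: for every positive integer $n$, Ann has a strategy guaranteeing that, no matter how Ben plays, the sequence of the first $n$ terms contains no repetition of size $h \geq 2$.
   Context: A repetition of size $h$ ($h \geq 1$) in a sequence is a block of consecutive terms of the form $x_1 \dots x_h x_1 \dots x_h$. The nonrepetitive game over a symbol set $S$ is played by two players, Ann (moving first) and Ben, who alternately choose, one by one, consecutive terms $s_1, s_2, s_3, \dots$ of a sequence over $S$ (Ann chooses the odd-indexed terms, Ben the even-indexed ones); nothing is ever erased. Ann tries to avoid repetitions, Ben tries to create them. -}

module Defs where

open import Data.Nat using (ℕ; zero; suc; _≥_)
open import Data.List using (List; []; _∷_; _++_; length; [_])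
open import Data.Product using (∃-syntax; _×_)
open import Relation.Binary.PropositionalEquality using (_≡_)
open import Relation.Nullary using (¬_)

-- A strategy (for either player) over symbol set S: given the sequence
-- played so far (in order s₁ … sₖ), choose the next term.
Strategy : Set → Set
Strategy S = List S → S

-- The sequence s₁ … sₙ of the first n terms when Ann plays `ann` and Ben
-- plays `ben`.  Term number k+1 (1-indexed) is chosen by Ann iff k is even
-- (i.e. Ann chooses odd-indexed terms, moving first).
mutual
  play : {S : Set} → Strategy S → Strategy S → ℕ → List S
  play ann ben zero    = []
  play ann ben (suc k) = play ann ben k ++ [ move ann ben k (play ann ben k) ]

  move : {S : Set} → Strategy S → Strategy S → ℕ → List S → S
  move ann ben zero          hist = ann hist
  move ann ben (suc zero)    hist = ben hist
  move ann ben (suc (suc k)) hist = move ann ben k hist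

HasRepetitionOfSize : {S : Set} → ℕ → List S → Set
HasRepetitionOfSize {S} h xs =
  ∃[ as ] ∃[ ys ] ∃[ bs ] (length ys ≡ h × xs ≡ as ++ ys ++ ys ++ bs)

NoLongRepetition : {S : Set} → List S → Set
NoLongRepetition xs = ∀ h → h ≥ 2 → ¬ HasRepetitionOfSize h xs

{-# OPTIONS --safe #-}
-- Ann only has to prevent, for each k ≥ 1, that her last k letters repeat
-- either her own k letters just before, or the k letters that Ben played 2k + 1
-- turns earlier: every repetition of size 2k or 2k + 1 contains such a clash.
-- Against a fixed strategy of Ben, both forbidden words are determined by what
-- precedes the last k letters.  So if gₙ is the number of clash-free words of
-- length n that Ann can play, then gₙ₊₁ ≥ 6gₙ − 2(g₀ + … + gₙ), and by induction
-- 2(g₀ + … + gₙ) ≤ 3gₙ, hence gₙ₊₁ ≥ 3gₙ > 0.  Thus Ben has no winning strategy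
-- in the finite game, which is determined.
module Submission where

open import Defs
open import Data.Bool using (Bool; true; false; not)
open import Data.Bool.Properties using (not-involutive)
open import Data.Empty using (⊥)
open import Data.Nat using (ℕ; zero; suc; pred; _+_; _*_; _∸_; _≤_; _<_; z≤n; s≤s)
open import Data.Nat.Properties
open import Data.Fin using (Fin; zero; toℕ; fromℕ<)
open import Data.Fin.Properties using (any?; all?; toℕ-fromℕ<; toℕ<n) renaming (_≟_ to _≟ᶠ_)
open import Data.List using (List; []; _∷_; [_]; _++_; length; map; take; drop; filter; reverse; allFin; cartesianProductWith)
open import Data.List.Properties using (≡-dec; ∷-injective; ++-assoc; length-++; length-map; length-drop; drop-drop; length-reverse; length-tabulate; length-++-sucʳ; length-++-≤ˡ; reverse-++; take++drop≡id)
open import Data.List.Membership.DecPropositional using (_∈?_)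
open import Data.List.Membership.Propositional using (_∈_)
open import Data.List.Membership.Propositional.Properties using (∈-∃++; ∈-++⁺ˡ; ∈-++⁺ʳ; ∈-++⁻; ∈-map⁺; ∈-filter⁺; ∈-filter⁻; ∈-cartesianProductWith⁻)
open import Data.List.Relation.Binary.Subset.Propositional using (_⊆_)
open import Data.List.Relation.Unary.All as All using ([]; _∷_)
open import Data.List.Relation.Unary.Any using (here; there)
open import Data.List.Relation.Unary.AllPairs using ([]; _∷_)
open import Data.List.Relation.Unary.Unique.Propositional using (Unique)
import Data.List.Relation.Unary.Unique.Propositional.Properties as Unique
open import Data.Product using (∃-syntax; _×_; _,_; proj₁; proj₂)
open import Data.Sum using (_⊎_; inj₁; inj₂)
open import Data.Unit using (⊤; tt)
open import Function using (_∘_)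
open import Relation.Binary.PropositionalEquality using (_≡_; refl; sym; trans; cong; cong₂; subst; module ≡-Reasoning)
open import Relation.Nullary using (¬_; Dec; yes; no; contradiction)
open import Relation.Nullary.Decidable using (_×-dec_; ¬?; map′; decidable-stable)

private
  variable
    A : Set
    q : ℕ

-- Counting with duplicate-free lists, and splitting of lists.

Unique-⊆⇒length≤ : {xs ys : List A} → Unique xs → xs ⊆ ys → length xs ≤ length ys
Unique-⊆⇒length≤ []           sub = z≤n
Unique-⊆⇒length≤ {xs = x ∷ xs} (x∉xs ∷ xs!) sub
  with ps , qs , refl ← ∈-∃++ (sub (here refl)) =
  ≤-trans (s≤s (Unique-⊆⇒length≤ xs! rest)) (≤-reflexive (sym (length-++-sucʳ ps x qs)))
  where
  rest : xs ⊆ ps ++ qs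
  rest {y} y∈xs with ∈-++⁻ ps (sub (there y∈xs))
  ... | inj₁ y∈ps           = ∈-++⁺ˡ y∈ps
  ... | inj₂ (here refl)    = contradiction refl (All.lookup x∉xs y∈xs)
  ... | inj₂ (there y∈qs)   = ∈-++⁺ʳ ps y∈qs

take-length-++ : (xs : List A) {ys : List A} {n : ℕ} → length xs ≡ n → take n (xs ++ ys) ≡ xs
take-length-++ []       refl = refl
take-length-++ (x ∷ xs) refl = cong (x ∷_) (take-length-++ xs refl)

drop-length-++ : (xs : List A) {ys : List A} {n : ℕ} → length xs ≡ n → drop n (xs ++ ys) ≡ ys
drop-length-++ []       refl = refl
drop-length-++ (x ∷ xs) refl = drop-length-++ xs refl

take-≤-++ : ∀ n (xs : List A) {ys zs : List A} → n ≤ length xs → take n (xs ++ ys) ≡ take n (xs ++ zs)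
take-≤-++ zero    xs       _         = refl
take-≤-++ (suc n) (x ∷ xs) (s≤s n≤) = cong (x ∷_) (take-≤-++ n xs n≤)

-- Separating the letters of the two players.

-- Histories of the game are listed with the most recent term first; in a history
-- zs that ends with a move of Ann, alternate true zs are the moves of Ann
-- and alternate false zs those of Ben.
alternate : Bool → List A → List A
alternate _     []       = []
alternate true  (x ∷ xs) = x ∷ alternate false xs
alternate false (x ∷ xs) = alternate true xs

-- The selector that `alternate t` has reached after reading `xs`. It differs from `t` exactly when
-- `xs` has odd length, so it records the parity of a period.
phase : Bool → List A → Bool
phase t []       = t
phase t (_ ∷ xs) = phase (not t) xs

alternate-++ : ∀ t (xs ys : List A) → alternate t (xs ++ ys) ≡ alternate t xs ++ alternate (phase t xs) ys
alternate-++ t     []       ys = refl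
alternate-++ true  (x ∷ xs) ys = cong (x ∷_) (alternate-++ false xs ys)
alternate-++ false (x ∷ xs) ys = alternate-++ true xs ys

phase-not : ∀ t (xs : List A) → phase (not t) xs ≡ not (phase t xs)
phase-not t []       = refl
phase-not t (x ∷ xs) = phase-not (not t) xs

phase-dichotomy : ∀ t (xs : List A) → phase t xs ≡ t ⊎ phase t xs ≡ not t
phase-dichotomy t xs with t | phase t xs
... | true  | true  = inj₁ refl
... | true  | false = inj₂ refl
... | false | true  = inj₂ refl
... | false | false = inj₁ refl

length-alternate-odd : (xs : List A) → phase true xs ≡ false → length (alternate true xs) ≡ suc (length (alternate false xs))
length-alternate-odd (x ∷ [])     _  = refl
length-alternate-odd (x ∷ y ∷ xs) eq = cong suc (length-alternate-odd xs eq)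

-- Clashes forced by squares.

Clash : List A → Bool → ℕ → Set
Clash zs t k = take k (alternate true zs) ≡ take k (drop k (alternate t zs))

-- Bounding the block length makes the condition decidable and loses nothing: for a longer block in
-- a nonempty history the right side of the clash is empty and the left side is not.
Safe : List A → Set
Safe zs = (k : Fin (length (alternate true zs))) → (t : Bool) → ¬ Clash zs t (suc (toℕ k))

Safe? : (zs : List (Fin q)) → Dec (Safe zs)
Safe? zs = all? λ k → map′ (λ { (p , r) true → p ; (p , r) false → r }) (λ f → f true , f false)
                          (¬? (clash? true k) ×-dec ¬? (clash? false k))
  where
  clash? : ∀ t (k : Fin (length (alternate true zs))) → Dec (Clash zs t (suc (toℕ k)))
  clash? t k = ≡-dec _≟ᶠ_ _ _

Safe⇒¬Clash : (zs : List A) → Safe zs → ∀ t {k} → 0 < k → k ≤ length (alternate true zs) → ¬ Clash zs t k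
Safe⇒¬Clash zs safe t {suc k} _ k< clash =
  safe (fromℕ< k<) t (subst (Clash zs t ∘ suc) (sym (toℕ-fromℕ< k<)) clash)

-- Here size at least 2 enters: a period of one term leaves one of the two selections empty, and an
-- empty block gives no clash.
length-alternate>0 : ∀ t (xs : List A) → 2 ≤ length xs → 0 < length (alternate t xs)
length-alternate>0 true  (x ∷ xs)     _ = s≤s z≤n
length-alternate>0 false (x ∷ y ∷ xs) _ = s≤s z≤n
length-alternate>0 t     (x ∷ [])     (s≤s ())

length-alternate≤ : ∀ t (xs ys : List A) → length (alternate t xs) ≤ length (alternate t (xs ++ ys))
length-alternate≤ t xs ys rewrite alternate-++ t xs ys = length-++-≤ˡ (alternate t xs)

even-square-clash : ∀ t (ys ps : List A) → phase t ys ≡ t →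
                    let k = length (alternate t ys) ; own = alternate t (ys ++ ys ++ ps) in
                    take k own ≡ take k (drop k own)
even-square-clash t ys ps even
  rewrite alternate-++ t ys (ys ++ ps) | even | alternate-++ t ys ps | even =
  trans (take-length-++ (alternate t ys) refl)
        (sym (trans (cong (take _) (drop-length-++ (alternate t ys) refl)) (take-length-++ (alternate t ys) refl)))

-- Across an odd period the players swap roles: Ann's letters in the later copy are Ben's in the
-- earlier one. She has one letter more than Ben in the later copy, and the clash omits her
-- earliest.
odd-square-clash-true : (ys ps : List A) → phase true ys ≡ false →
                        Clash (ys ++ ys ++ ps) false (length (alternate false ys))
odd-square-clash-true ys ps odd
  rewrite alternate-++ true ys (ys ++ ps) | alternate-++ false ys (ys ++ ps) | phase-not true ys | odd
        | alternate-++ true ys ps =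
  trans (take-≤-++ _ (alternate true ys) (≤-trans (n≤1+n _) (≤-reflexive (sym (length-alternate-odd ys odd)))))
        (cong (take _) (sym (drop-length-++ (alternate false ys) refl)))

-- The head of this history is a letter of Ben. Removing it turns `suc k` into `k`, so the equation
-- computes to a `Clash` just before his move.
odd-square-clash-false : (ys ps : List A) → phase true ys ≡ false →
                         let k = length (alternate false ys) ; zs = ys ++ ys ++ ps in
                         take k (alternate false zs) ≡ take k (drop (suc k) (alternate true zs))
odd-square-clash-false ys ps odd
  rewrite alternate-++ true ys (ys ++ ps) | alternate-++ false ys (ys ++ ps) | phase-not true ys | odd
        | alternate-++ false ys ps =
  trans (take-length-++ (alternate false ys) refl)
        (sym (trans (cong (take _) (drop-length-++ (alternate true ys) (length-alternate-odd ys odd)))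
                    (take-length-++ (alternate false ys) refl)))

square⇒¬Safe-ann : (ys ps : List A) → 2 ≤ length ys → ¬ Safe (ys ++ ys ++ ps)
square⇒¬Safe-ann ys ps 2≤ safe with phase-dichotomy true ys
... | inj₁ even = Safe⇒¬Clash (ys ++ ys ++ ps) safe true (length-alternate>0 true ys 2≤) (length-alternate≤ true ys _)
                    (even-square-clash true ys ps even)
... | inj₂ odd  = Safe⇒¬Clash (ys ++ ys ++ ps) safe false (length-alternate>0 false ys 2≤)
                    (≤-trans (≤-trans (n≤1+n _) (≤-reflexive (sym (length-alternate-odd ys odd))))
                             (length-alternate≤ true ys _))
                    (odd-square-clash-true ys ps odd)

-- The history is a square without Ben's closing letter. The clash avoids that letter, so it is
-- already there once Ann has moved; this is why constraints on her moves alone also stop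
-- repetitions that Ben completes.
square⇒¬Safe-ben : ∀ b (ys ps : List A) → 2 ≤ length (b ∷ ys) → ¬ Safe (ys ++ b ∷ ys ++ ps)
square⇒¬Safe-ben b ys ps 2≤ safe with phase-dichotomy false (b ∷ ys)
... | inj₁ even = Safe⇒¬Clash (ys ++ b ∷ ys ++ ps) safe true (length-alternate>0 false (b ∷ ys) 2≤) (length-alternate≤ false (b ∷ ys) _)
                    (even-square-clash false (b ∷ ys) ps even)
... | inj₂ odd  = Safe⇒¬Clash (ys ++ b ∷ ys ++ ps) safe false (length-alternate>0 false (b ∷ ys) 2≤) (length-alternate≤ false (b ∷ ys) _)
                    (odd-square-clash-false (b ∷ ys) ps (trans (phase-not false (b ∷ ys)) (cong not odd)))

-- Histories kept safe by Ann.

data SafeHistory {A : Set} : Bool → List A → Set where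
  start    : SafeHistory false []
  benMoved : ∀ {b zs} → SafeHistory true zs → SafeHistory false (b ∷ zs)
  annMoved : ∀ {a zs} → SafeHistory false zs → Safe (a ∷ zs) → SafeHistory true (a ∷ zs)

-- Moves are undone until the square stands at the head, the moment of its completion; who moved
-- last then decides between the two cases.
SafeHistory⇒no-square : ∀ {t} (qs ys ps : List A) → 2 ≤ length ys → ¬ SafeHistory t (qs ++ ys ++ ys ++ ps)
SafeHistory⇒no-square (_ ∷ qs) ys       ps 2≤ (benMoved h)            = SafeHistory⇒no-square qs ys ps 2≤ h
SafeHistory⇒no-square (_ ∷ qs) ys       ps 2≤ (annMoved h _)          = SafeHistory⇒no-square qs ys ps 2≤ h
SafeHistory⇒no-square []       (b ∷ ys) ps 2≤ (annMoved h safe)       = square⇒¬Safe-ann (b ∷ ys) ps 2≤ safe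
SafeHistory⇒no-square []       (b ∷ []) ps (s≤s ()) (benMoved h)
SafeHistory⇒no-square []       (b ∷ y ∷ ys) ps 2≤ (benMoved (annMoved h safe)) = square⇒¬Safe-ben b (y ∷ ys) ps 2≤ safe

SafeHistory⇒NoLongRepetition : ∀ {t} (xs : List A) → SafeHistory t (reverse xs) → NoLongRepetition xs
SafeHistory⇒NoLongRepetition xs h _ 2≤h (as , ys , bs , refl , refl) =
  SafeHistory⇒no-square (reverse bs) (reverse ys) (reverse as)
    (subst (2 ≤_) (sym (length-reverse ys)) 2≤h) (subst (SafeHistory _) eq h)
  where
  open ≡-Reasoning
  eq : reverse (as ++ ys ++ ys ++ bs) ≡ reverse bs ++ reverse ys ++ reverse ys ++ reverse as
  eq = begin
    reverse (as ++ ys ++ ys ++ bs)                              ≡⟨ reverse-++ as _ ⟩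
    reverse (ys ++ ys ++ bs) ++ reverse as                      ≡⟨ cong (_++ reverse as) (reverse-++ ys _) ⟩
    (reverse (ys ++ bs) ++ reverse ys) ++ reverse as            ≡⟨ cong (λ z → (z ++ reverse ys) ++ reverse as) (reverse-++ ys bs) ⟩
    ((reverse bs ++ reverse ys) ++ reverse ys) ++ reverse as    ≡⟨ ++-assoc (reverse bs ++ reverse ys) _ _ ⟩
    (reverse bs ++ reverse ys) ++ reverse ys ++ reverse as      ≡⟨ ++-assoc (reverse bs) _ _ ⟩
    reverse bs ++ reverse ys ++ reverse ys ++ reverse as        ∎

-- Clash-free words against a fixed strategy of Ben.

length-cartesianProductWith : {B C : Set} (f : A → B → C) (xs : List A) (ys : List B) →
                              length (cartesianProductWith f xs ys) ≡ length xs * length ys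
length-cartesianProductWith f []       ys = refl
length-cartesianProductWith f (x ∷ xs) ys =
  trans (length-++ (map (f x) ys)) (cong₂ _+_ (length-map (f x) ys) (length-cartesianProductWith f xs ys))

-- Here and below, r is Ben's strategy: his reply to a history that ends with a
-- move of Ann.
weave : (List A → A) → List A → List A
weave r []      = []
weave r (a ∷ w) = r (a ∷ weave r w) ∷ a ∷ weave r w

replies : (List A → A) → List A → List A
replies r w = alternate true (weave r w)

alternate-weave : (r : List A → A) (w : List A) → alternate false (weave r w) ≡ w
alternate-weave r []      = refl
alternate-weave r (a ∷ w) = cong (a ∷_) (alternate-weave r w)

-- Ben's replies cannot depend on later letters of Ann: dropping her newest letters merely undoes
-- the latest rounds. Hence the forbidden block is a function of the suffix before it.
drop-replies : ∀ (r : List A → A) k w → drop k (replies r w) ≡ replies r (drop k w)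
drop-replies r zero    w       = refl
drop-replies r (suc k) []      = refl
drop-replies r (suc k) (a ∷ w) = drop-replies r k w

ClashFree : (List A → A) → List A → Set
ClashFree r []      = ⊤
ClashFree r (a ∷ w) = ClashFree r w × Safe (a ∷ weave r w)

ClashFree? : (r : List (Fin q) → Fin q) (w : List (Fin q)) → Dec (ClashFree r w)
ClashFree? r []      = yes tt
ClashFree? r (a ∷ w) = ClashFree? r w ×-dec Safe? (a ∷ weave r w)

extensions : List (List (Fin q)) → List (List (Fin q))
extensions ws = cartesianProductWith _∷_ (allFin _) ws

clashFreeWords : (List (Fin q) → Fin q) → ℕ → List (List (Fin q))
clashFreeWords r zero    = [ [] ]
clashFreeWords r (suc n) = filter (ClashFree? r) (extensions (clashFreeWords r n))

clashFreeWords≤ : (List (Fin q) → Fin q) → ℕ → List (List (Fin q))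
clashFreeWords≤ r zero    = clashFreeWords r zero
clashFreeWords≤ r (suc n) = clashFreeWords r (suc n) ++ clashFreeWords≤ r n

clashFreeWords-Unique : ∀ (r : List (Fin q) → Fin q) n → Unique (clashFreeWords r n)
clashFreeWords-Unique r zero    = [] ∷ []
clashFreeWords-Unique r (suc n) = Unique.filter⁺ (ClashFree? r)
  (Unique.cartesianProductWith⁺ _∷_ ∷-injective (Unique.allFin⁺ _) (clashFreeWords-Unique r n))

∈-clashFreeWords⇒ClashFree : ∀ (r : List (Fin q) → Fin q) n {w} → w ∈ clashFreeWords r n → ClashFree r w
∈-clashFreeWords⇒ClashFree r zero    (here refl) = tt
∈-clashFreeWords⇒ClashFree r (suc n) w∈          = proj₂ (∈-filter⁻ (ClashFree? r) {xs = extensions (clashFreeWords r n)} w∈)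

∈-clashFreeWords-uncons : ∀ (r : List (Fin q) → Fin q) n {w} → w ∈ clashFreeWords r (suc n) →
                          ∃[ a ] ∃[ w′ ] (w′ ∈ clashFreeWords r n × w ≡ a ∷ w′)
∈-clashFreeWords-uncons r n w∈
  with a , w′ , _ , w′∈ , eq ← ∈-cartesianProductWith⁻ _∷_ (allFin _) (clashFreeWords r n)
         (proj₁ (∈-filter⁻ (ClashFree? r) {xs = extensions (clashFreeWords r n)} w∈)) = a , w′ , w′∈ , eq

∈-clashFreeWords⇒length : ∀ (r : List (Fin q) → Fin q) n {w} → w ∈ clashFreeWords r n → length w ≡ n
∈-clashFreeWords⇒length r zero    (here refl) = refl
∈-clashFreeWords⇒length r (suc n) w∈ with _ , _ , w′∈ , refl ← ∈-clashFreeWords-uncons r n w∈ =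
  cong suc (∈-clashFreeWords⇒length r n w′∈)

drop-∈-clashFreeWords≤ : ∀ (r : List (Fin q) → Fin q) n k {w} → w ∈ clashFreeWords r n → drop k w ∈ clashFreeWords≤ r n
drop-∈-clashFreeWords≤ r zero    zero    w∈          = w∈
drop-∈-clashFreeWords≤ r zero    (suc k) (here refl) = here refl
drop-∈-clashFreeWords≤ r (suc n) zero    w∈          = ∈-++⁺ˡ w∈
drop-∈-clashFreeWords≤ r (suc n) (suc k) w∈ with _ , _ , w′∈ , refl ← ∈-clashFreeWords-uncons r n w∈ =
  ∈-++⁺ʳ (clashFreeWords r (suc n)) (drop-∈-clashFreeWords≤ r n k w′∈)

-- Ben's latest reply is skipped: before a block of k letters of Ann, it is only
-- 2k − 1 turns away from the letter that it would be compared with, not 2k + 1.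
target : (List A → A) → Bool → List A → List A
target r true  w = w
target r false w = drop 1 (replies r w)

drop-alternate : ∀ (r : List A → A) a t k w →
                 drop (suc k) (alternate t (a ∷ weave r w)) ≡ target r t (drop k w)
drop-alternate r a true  k w = cong (drop k) (alternate-weave r w)
drop-alternate r a false k w = begin
  drop (suc k) (replies r w)     ≡⟨ cong (λ j → drop j (replies r w)) (+-comm 1 k) ⟩
  drop (k + 1) (replies r w)     ≡⟨ drop-drop k 1 (replies r w) ⟨
  drop 1 (drop k (replies r w))  ≡⟨ cong (drop 1) (drop-replies r k w) ⟩
  target r false (drop k w)      ∎
  where open ≡-Reasoning

-- The only word of length n + 1 that can extend w by a block that clashes with
-- target r t w.
forced : (List A → A) → ℕ → Bool → List A → List A
forced r n t w = take (suc (n ∸ length w)) (target r t w) ++ w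

clash⇒forced : ∀ (r : List A → A) {n} a t k w → length w ≡ n → k ≤ n →
               Clash (a ∷ weave r w) t (suc k) → a ∷ w ≡ forced r n t (drop k w)
clash⇒forced r {n} a t k w refl k≤n clash = begin
  a ∷ w                                                               ≡⟨ take++drop≡id (suc k) (a ∷ w) ⟨
  take (suc k) (a ∷ w) ++ drop k w                                    ≡⟨ cong (λ v → take (suc k) (a ∷ v) ++ drop k w) (alternate-weave r w) ⟨
  take (suc k) (alternate true (a ∷ weave r w)) ++ drop k w           ≡⟨ cong (_++ drop k w) clash ⟩
  take (suc k) (drop (suc k) (alternate t (a ∷ weave r w))) ++ drop k w
                                                                      ≡⟨ cong (λ v → take (suc k) v ++ drop k w) (drop-alternate r a t k w) ⟩
  take (suc k) (target r t (drop k w)) ++ drop k w                    ≡⟨ cong (λ j → take (suc j) (target r t (drop k w)) ++ drop k w) k≡ ⟨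
  forced r n t (drop k w)                                             ∎
  where
  open ≡-Reasoning
  -- The suffix reveals the block length, so a suffix and a choice of `t` fix the forced word: two
  -- for each clash-free word of length at most n.
  k≡ : n ∸ length (drop k w) ≡ k
  k≡ = trans (cong (n ∸_) (length-drop k w)) (m∸[m∸n]≡n k≤n)

-- Counting the extensions.

forcedWords : (List (Fin q) → Fin q) → ℕ → List (List (Fin q))
forcedWords r n = map (forced r n true) (clashFreeWords≤ r n) ++ map (forced r n false) (clashFreeWords≤ r n)

∈-forcedWords : ∀ (r : List (Fin q) → Fin q) n t {w} → w ∈ clashFreeWords≤ r n → forced r n t w ∈ forcedWords r n
∈-forcedWords r n true  w∈ = ∈-++⁺ˡ (∈-map⁺ (forced r n true) w∈)
∈-forcedWords r n false w∈ = ∈-++⁺ʳ (map (forced r n true) (clashFreeWords≤ r n)) (∈-map⁺ (forced r n false) w∈)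

extensions-⊆ : ∀ (r : List (Fin q) → Fin q) n →
               extensions (clashFreeWords r n) ⊆ clashFreeWords r (suc n) ++ forcedWords r n
-- Splitting on membership in the forced list, rather than on `Safe`, refutes every clash directly;
-- none has to be extracted from a failure of `Safe`.
extensions-⊆ r n {v} v∈ with _∈?_ (≡-dec _≟ᶠ_) v (forcedWords r n)
... | yes v∈forced = ∈-++⁺ʳ (clashFreeWords r (suc n)) v∈forced
... | no  v∉forced
  with a , w , _ , w∈ , refl ← ∈-cartesianProductWith⁻ _∷_ (allFin _) (clashFreeWords r n) v∈ =
  ∈-++⁺ˡ (∈-filter⁺ (ClashFree? r) v∈ (∈-clashFreeWords⇒ClashFree r n w∈ , safe))
  where
  |w| : length w ≡ n
  |w| = ∈-clashFreeWords⇒length r n w∈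
  safe : Safe (a ∷ weave r w)
  safe k t clash = v∉forced
    (subst (_∈ forcedWords r n) (sym (clash⇒forced r a t (toℕ k) w |w| k≤n clash))
           (∈-forcedWords r n t (drop-∈-clashFreeWords≤ r n (toℕ k) w∈)))
    where
    k≤n : toℕ k ≤ n
    k≤n = ≤-pred (subst (toℕ k <_) (cong suc (trans (cong length (alternate-weave r w)) |w|)) (toℕ<n k))

extensions-count : ∀ (r : List (Fin q) → Fin q) n →
  q * length (clashFreeWords r n) ≤ length (clashFreeWords r (suc n)) + 2 * length (clashFreeWords≤ r n)
extensions-count {q} r n = begin
  q * length W                                  ≡⟨ cong (_* length W) (length-tabulate {n = q} (λ i → i)) ⟨
  length (allFin q) * length W                  ≡⟨ length-cartesianProductWith _∷_ (allFin q) W ⟨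
  -- Only the extensions must be distinct; forced words may repeat or be too short, since
  -- overcounting them is harmless.
  length (extensions W)                         ≤⟨ Unique-⊆⇒length≤
                                                     (Unique.cartesianProductWith⁺ _∷_ ∷-injective (Unique.allFin⁺ q) (clashFreeWords-Unique r n))
                                                     (extensions-⊆ r n) ⟩
  length (W′ ++ forcedWords r n)                ≡⟨ length-++ W′ ⟩
  length W′ + length (forcedWords r n)          ≡⟨ cong (length W′ +_) (length-++ (map (forced r n true) P)) ⟩
  length W′ + (length (map (forced r n true) P) + length (map (forced r n false) P))
                                                ≡⟨ cong (length W′ +_) (cong₂ _+_ (length-map (forced r n true) P)
                                                     (trans (length-map (forced r n false) P) (sym (+-identityʳ _)))) ⟩
  length W′ + 2 * length P                      ∎
  where
  open ≤-Reasoning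
  W = clashFreeWords r n
  W′ = clashFreeWords r (suc n)
  P = clashFreeWords≤ r n

-- A growth factor c > 1 sustains itself if c + 2c/(c - 1) ≤ 6, as the sum of the counts is then at
-- most c/(c - 1) times the last. This means (c - 2)(c - 3) ≤ 0, and c = 3 is taken; with 5 in place
-- of 6 there is no solution.
clashFreeWords-grow : ∀ (r : List (Fin 6) → Fin 6) n →
                      3 * length (clashFreeWords r n) ≤ length (clashFreeWords r (suc n))
clashFreeWords≤-bound : ∀ (r : List (Fin 6) → Fin 6) n →
                        2 * length (clashFreeWords≤ r n) ≤ 3 * length (clashFreeWords r n)

clashFreeWords-grow r n = +-cancelʳ-≤ (3 * g) (3 * g) g′ (begin
  3 * g + 3 * g                         ≡⟨ *-distribʳ-+ g 3 3 ⟨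
  6 * g                                 ≤⟨ extensions-count r n ⟩
  g′ + 2 * length (clashFreeWords≤ r n) ≤⟨ +-monoʳ-≤ g′ (clashFreeWords≤-bound r n) ⟩
  g′ + 3 * g                            ∎)
  where
  open ≤-Reasoning
  g = length (clashFreeWords r n)
  g′ = length (clashFreeWords r (suc n))

clashFreeWords≤-bound r zero    = s≤s (s≤s z≤n)
clashFreeWords≤-bound r (suc n) = begin
  2 * length (clashFreeWords≤ r (suc n))       ≡⟨ cong (2 *_) (length-++ (clashFreeWords r (suc n))) ⟩
  2 * (g′ + length (clashFreeWords≤ r n))      ≡⟨ *-distribˡ-+ 2 g′ _ ⟩
  2 * g′ + 2 * length (clashFreeWords≤ r n)    ≤⟨ +-monoʳ-≤ (2 * g′) (clashFreeWords≤-bound r n) ⟩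
  2 * g′ + 3 * length (clashFreeWords r n)     ≤⟨ +-monoʳ-≤ (2 * g′) (clashFreeWords-grow r n) ⟩
  2 * g′ + g′                                  ≡⟨ +-comm (2 * g′) g′ ⟩
  3 * g′                                       ∎
  where
  open ≤-Reasoning
  g′ = length (clashFreeWords r (suc n))

clashFreeWords-nonempty : ∀ (r : List (Fin 6) → Fin 6) n → 1 ≤ length (clashFreeWords r n)
clashFreeWords-nonempty r zero    = ≤-refl
clashFreeWords-nonempty r (suc n) =
  ≤-trans (clashFreeWords-nonempty r n) (≤-trans (m≤m+n _ _) (clashFreeWords-grow r n))

-- Determinacy of the finite game.

-- The Boolean is true when Ben is the next to move.
AnnWins : Bool → ℕ → List (Fin q) → Set
AnnWins t     zero    zs = ⊤
AnnWins false (suc m) zs = ∃[ a ] (Safe (a ∷ zs) × AnnWins true m (a ∷ zs))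
AnnWins true  (suc m) zs = ∀ b → AnnWins false m (b ∷ zs)

abstract
  AnnWins? : ∀ t m (zs : List (Fin q)) → Dec (AnnWins t m zs)
  AnnWins? t     zero    zs = yes tt
  AnnWins? false (suc m) zs = any? λ a → Safe? (a ∷ zs) ×-dec AnnWins? true m (a ∷ zs)
  AnnWins? true  (suc m) zs = all? λ b → AnnWins? false m (b ∷ zs)

counterReply : ℕ → List (Fin 6) → Fin 6
counterReply m zs with any? (λ b → ¬? (AnnWins? false (pred m) (b ∷ zs)))
... | yes (b , _) = b
-- An arbitrary default, never reached when Ann's position is lost.
... | no  _       = zero

counterReply-wins : ∀ m (zs : List (Fin 6)) → ¬ AnnWins true m zs →
                    ¬ AnnWins false (pred m) (counterReply m zs ∷ zs)
counterReply-wins zero    zs lost = contradiction tt lost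
counterReply-wins (suc m) zs lost with any? (λ b → ¬? (AnnWins? false m (b ∷ zs)))
... | yes (_ , b-wins) = b-wins
... | no  none         = contradiction (λ b → decidable-stable (AnnWins? false m (b ∷ zs)) (λ ¬w → none (b , ¬w))) lost

benReply : ℕ → List (Fin 6) → Fin 6
benReply n zs = counterReply (n ∸ length zs) zs

ann-moves : ∀ m a (zs : List (Fin q)) → Safe (a ∷ zs) → AnnWins true (pred m) (a ∷ zs) → AnnWins false m zs
ann-moves zero    a zs _    _ = tt
ann-moves (suc m) a zs safe w = a , safe , w

-- Were Ann's position after a safe letter won, so would be the one before it; Ben's reply then
-- keeps it lost. With no terms left `AnnWins` holds trivially, so no clash-free word can last to
-- the end of the game.
ClashFree⇒lost : ∀ n → ¬ AnnWins false n [] → ∀ w → ClashFree (benReply n) w →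
                 let zs = weave (benReply n) w in ¬ AnnWins false (n ∸ length zs) zs
ClashFree⇒lost n lost []      _          = lost
ClashFree⇒lost n lost (a ∷ w) (cf , safe) =
  subst (λ m → ¬ AnnWins false m (weave (benReply n) (a ∷ w))) (pred[m∸n]≡m∸[1+n] n (suc (length zs)))
    (counterReply-wins (n ∸ suc (length zs)) (a ∷ zs)
      (ClashFree⇒lost n lost w cf ∘ ann-moves (n ∸ length zs) a zs safe ∘
       subst (λ m → AnnWins true m (a ∷ zs)) (sym (pred[m∸n]≡m∸[1+n] n (length zs)))))
  where
  zs = weave (benReply n) w

length≤length-weave : (r : List A → A) (w : List A) → length w ≤ length (weave r w)
length≤length-weave r []      = z≤n
length≤length-weave r (a ∷ w) = s≤s (m≤n⇒m≤1+n (length≤length-weave r w))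

ann-wins : ∀ n → AnnWins {6} false n []
ann-wins n = decidable-stable (AnnWins? false n []) λ lost → impossible lost _ refl
  where
  impossible : ¬ AnnWins false n [] → ∀ ws → clashFreeWords (benReply n) n ≡ ws → ⊥
  impossible lost []      eq with () ← subst (1 ≤_) (cong length eq) (clashFreeWords-nonempty (benReply n) n)
  -- With Ben's replies, n letters of Ann fill at least n turns, so no terms remain.
  impossible lost (w ∷ _) eq = ClashFree⇒lost n lost w (∈-clashFreeWords⇒ClashFree (benReply n) n w∈)
    (subst (λ m → AnnWins false m (weave (benReply n) w)) (sym (m≤n⇒m∸n≡0 n≤)) tt)
    where
    w∈ : w ∈ clashFreeWords (benReply n) n
    w∈ = subst (w ∈_) (sym eq) (here refl)
    n≤ : n ≤ length (weave (benReply n) w)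
    n≤ = subst (_≤ length (weave (benReply n) w)) (∈-clashFreeWords⇒length (benReply n) n w∈) (length≤length-weave (benReply n) w)

-- Ann's strategy and the resulting play.

winningMove : ℕ → List (Fin 6) → Fin 6
winningMove m zs with AnnWins? false m zs
winningMove zero    zs | _           = zero
winningMove (suc m) zs | yes (a , _) = a
winningMove (suc m) zs | no  _       = zero

winningMove-wins : ∀ m (zs : List (Fin 6)) → AnnWins false (suc m) zs →
                   let a = winningMove (suc m) zs in Safe (a ∷ zs) × AnnWins true m (a ∷ zs)
winningMove-wins m zs w with AnnWins? false (suc m) zs
... | yes (_ , p) = p
... | no  lost    = contradiction w lost

-- Strategies see the terms in chronological order, whereas `AnnWins` has the newest first.
annStrategy : ℕ → Strategy (Fin 6)
annStrategy n xs = winningMove (n ∸ length xs) (reverse xs)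

benToMove : ℕ → Bool
benToMove zero    = false
benToMove (suc k) = not (benToMove k)

move-ann : ∀ (ann ben : Strategy A) k xs → benToMove k ≡ false → move ann ben k xs ≡ ann xs
move-ann ann ben zero          xs eq = refl
move-ann ann ben (suc (suc k)) xs eq = move-ann ann ben k xs (trans (sym (not-involutive _)) eq)

length-play : ∀ (ann ben : Strategy A) k → length (play ann ben k) ≡ k
length-play ann ben zero    = refl
length-play ann ben (suc k) = trans (length-++ (play ann ben k)) (trans (+-comm _ 1) (cong suc (length-play ann ben k)))

-- The condition on `x` binds Ann's turns only; any term of Ben is covered by the quantifier in
-- `AnnWins true`.
next-turn : ∀ t {m x} {zs : List (Fin 6)} → SafeHistory t zs → AnnWins t (suc m) zs →
            (t ≡ false → x ≡ winningMove (suc m) zs) →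
            SafeHistory (not t) (x ∷ zs) × AnnWins (not t) m (x ∷ zs)
next-turn true          h w _  = benMoved h , w _
next-turn false {m} {_} {zs} h w x≡ with x≡ refl
... | refl with safe , w′ ← winningMove-wins m zs w = annMoved h safe , w′

winning-play : ∀ n ben k m → k + m ≡ n → let zs = reverse (play (annStrategy n) ben k) in
               SafeHistory (benToMove k) zs × AnnWins (benToMove k) m zs
winning-play n ben zero    m refl = start , ann-wins n
winning-play n ben (suc k) m eq
  with h , w ← winning-play n ben k (suc m) (trans (+-suc k m) eq) =
  subst (λ zs → SafeHistory (benToMove (suc k)) zs × AnnWins (benToMove (suc k)) m zs)
        (sym (reverse-++ xs [ move (annStrategy n) ben k xs ]))
        (next-turn (benToMove k) h w λ turn →
          trans (move-ann (annStrategy n) ben k xs turn)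
                (cong (λ j → winningMove j (reverse xs)) remaining))
  where
  open ≡-Reasoning
  xs = play (annStrategy n) ben k
  remaining : n ∸ length xs ≡ suc m
  remaining = begin
    n ∸ length xs    ≡⟨ cong (n ∸_) (length-play (annStrategy n) ben k) ⟩
    n ∸ k            ≡⟨ cong (_∸ k) (trans (+-suc k m) eq) ⟨
    k + suc m ∸ k    ≡⟨ m+n∸m≡n k (suc m) ⟩
    suc m            ∎

theorem2 : (n : ℕ) → ∃[ ann ] ((ben : Strategy (Fin 6)) → NoLongRepetition (play ann ben n))
theorem2 n = annStrategy n , λ ben →
  SafeHistory⇒NoLongRepetition _ (proj₁ (winning-play n ben n 0 (+-identityʳ n)))
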